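{- If Markov induction holds, then for any oracle $\chi:A\to\nabla_0B$, Markov induction also holds internally in the reflective subuniverse of $\bigcirc_\chi$-modal types; that is, it holds when the universe is replaced by the universe $\mathcal{U}_{\bigcirc_\chi}$ of $\bigcirc_\chi$-modal types, the natural numbers by $\bigcirc_\chi\mathbb{N}$, and $\nabla_0$, $\mathtt{IsSuc}$ are formed from these data inside the subuniverse.
   Context: Setting: homotopy type theory with a univalent universe $\mathcal{U}$ of small types and higher inductive types. It is assumed that there is a small type $\Omega_{\neg\neg}:\mathcal{U}$ classifying $\neg\neg$-stable propositions. For a type $X$, $\nabla_0X$ is the type of $\xi:X\to\Omega_{\neg\neg}$ such that $\neg\neg\sum_{x:X}\xi(x)$ and $\prod_{x,y:X}\xi(x)\to\xi(y)\to\neg\neg(x=y)$; write $\xi\downarrow:=\sum_{x:X}\xi(x)$ and $\xi\downarrow=x$ for $\xi(x)$. The nullification at a family $B:A\to\mathcal{U}$ is the higher modality whose modal types are exactly the $X$ with every constant map $X\to X^{B(a)}$ an equivalence; its modal types form a reflective subuniverse closed under $\Pi$, $\Sigma$ and identity types. An oracle is a map $\chi:A\to\nabla_0B$; the oracle modality $\bigcirc_\chi$ is the nullification at $a\mapsto\chi(a)\downarrow$. Markov induction (MI): write $\mathtt{IsSuc}(\mu,\nu):=\prod_{m:\mathbb{N}}(\mu\downarrow=m)\to(\nu\downarrow=m+1)$ for $\mu,\nu:\nabla_0\mathbb{N}$; MI asserts that for every $P:\nabla_0\mathbb{N}\to\mathcal{U}$ and every $h:\prod_{\nu:\nabla_0\mathbb{N}}\left(\prod_{\mu:\nabla_0\mathbb{N}}\mathtt{IsSuc}(\mu,\nu)\to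 P(\mu)\right)\to P(\nu)$ there is a section $\prod_{\nu:\nabla_0\mathbb{N}}P(\nu)$. -}

{-# OPTIONS --without-K #-}

-- The small types are those of Set.  Everything is set up so as to make sense
-- in homotopy type theory: no K, and of the consequences of univalence only
-- function extensionality on Set (taken as an explicit hypothesis) is used.
module Defs where

open import Axiom.Extensionality.Propositional using (Extensionality)
open import Data.Empty using (⊥; ⊥-elim)
open import Data.Nat.Base using (ℕ; suc)
open import Data.Product using (Σ; Σ-syntax; _×_; _,_; proj₁; proj₂)
open import Function.Base using (_∘_; id; const)
open import Function.Bundles using (_⇔_; Equivalence)
open import Level using (0ℓ)
open import Relation.Binary.PropositionalEquality
  using (_≡_; refl; sym; trans; cong; subst)
open import Relation.Nullary using (¬_; Irrelevant)

isContr : Set → Set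
isContr X = Σ[ c ∈ X ] (∀ x → c ≡ x)

-- Bi-invertible maps.
isEquiv : {X Y : Set} → (X → Y) → Set
isEquiv {X} {Y} f =
  (Σ[ g ∈ (Y → X) ] (∀ y → f (g y) ≡ y)) ×
  (Σ[ h ∈ (Y → X) ] (∀ x → h (f x) ≡ x))

_≃_ : Set → Set → Set
X ≃ Y = Σ[ f ∈ (X → Y) ] isEquiv f

-- What must be specified of a (sub)universe in order to read ∇₀, IsSuc and
-- Markov induction in it.  Π, Σ and identity types are those of Set, under
-- which the subuniverses of interest are closed; the empty type (hence
-- negation) and the natural numbers depend on the subuniverse.
record Universe : Set₂ where
  field
    Type : Set₁
    ⟦_⟧  : Type → Set
    𝟘    : Type
    N    : Type
    succ : ⟦ N ⟧ → ⟦ N ⟧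

  Neg : Set → Set
  Neg X = X → ⟦ 𝟘 ⟧

-- For the universe of all small types the contractibility condition says, given
-- univalence, that Holds is an equivalence of Ω with the type of ¬¬-stable
-- propositions.
record StablePropClassifier (𝒰 : Universe) : Set₁ where
  open Universe 𝒰
  field
    Ω        : Type
    Holds    : ⟦ Ω ⟧ → Type
    isProp   : ∀ ω → Irrelevant ⟦ Holds ω ⟧
    stable   : ∀ ω → Neg (Neg ⟦ Holds ω ⟧) → ⟦ Holds ω ⟧
    classify : (P : Type) → Irrelevant ⟦ P ⟧ → (Neg (Neg ⟦ P ⟧) → ⟦ P ⟧) →
               isContr (Σ[ ω ∈ ⟦ Ω ⟧ ] (⟦ Holds ω ⟧ ≃ ⟦ P ⟧))

module _ {𝒰 : Universe} (Ω¬¬ : StablePropClassifier 𝒰) where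
  open Universe 𝒰
  open StablePropClassifier Ω¬¬

  ∇₀ : Type → Set
  ∇₀ X = Σ[ ξ ∈ (⟦ X ⟧ → ⟦ Ω ⟧) ]
           Neg (Neg (Σ[ x ∈ ⟦ X ⟧ ] ⟦ Holds (ξ x) ⟧)) ×
           (∀ x y → ⟦ Holds (ξ x) ⟧ → ⟦ Holds (ξ y) ⟧ → Neg (Neg (x ≡ y)))

  infix 4 _↓≡_

  _↓≡_ : {X : Type} → ∇₀ X → ⟦ X ⟧ → Set
  (ξ , _) ↓≡ x = ⟦ Holds (ξ x) ⟧

  _↓ : {X : Type} → ∇₀ X → Set
  _↓ {X} ξ = Σ[ x ∈ ⟦ X ⟧ ] _↓≡_ {X} ξ x

  IsSuc : ∇₀ N → ∇₀ N → Set
  IsSuc μ ν = (m : ⟦ N ⟧) → μ ↓≡ m → ν ↓≡ succ m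

  MarkovInduction : Set₁
  MarkovInduction =
    (P : ∇₀ N → Type) →
    ((ν : ∇₀ N) → ((μ : ∇₀ N) → IsSuc μ ν → ⟦ P μ ⟧) → ⟦ P ν ⟧) →
    (ν : ∇₀ N) → ⟦ P ν ⟧

𝒰₀ : Universe
𝒰₀ = record { Type = Set ; ⟦_⟧ = id ; 𝟘 = ⊥ ; N = ℕ ; succ = suc }

-- Higher modalities in the sense of Rijke, Shulman and Spitters.
record HigherModality : Set₁ where
  field
    ○       : Set → Set
    η       : {X : Set} → X → ○ X
    ○-ind   : {X : Set} (P : ○ X → Set) →
              ((x : X) → ○ (P (η x))) → (z : ○ X) → ○ (P z)
    ○-ind-β : {X : Set} (P : ○ X → Set) (f : (x : X) → ○ (P (η x))) →
              (x : X) → ○-ind P f (η x) ≡ f x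
    ○-≡     : {X : Set} (x y : ○ X) → isEquiv (η {x ≡ y})

  isModal : Set → Set
  isModal X = isEquiv (η {X})

  ○-map : {X Y : Set} → (X → Y) → ○ X → ○ Y
  ○-map {Y = Y} f = ○-ind (λ _ → Y) (η ∘ f)

  ○-isModal : (X : Set) → isModal (○ X)
  ○-isModal X = (fold , η-fold) , (fold , fold-η)
    where
    fold : ○ (○ X) → ○ X
    fold = ○-ind (λ _ → X) id

    fold-η : ∀ x → fold (η x) ≡ x
    fold-η = ○-ind-β (λ _ → X) id

    η-fold : ∀ z → η (fold z) ≡ z
    η-fold z = proj₁ (proj₁ (○-≡ (η (fold z)) z))
      (○-ind (λ z → η (fold z) ≡ z) (λ x → η (cong η (fold-η x))) z)

isNull : {A : Set} → (A → Set) → Set → Set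
isNull {A} S X = (a : A) → isEquiv (const {A = X} {B = S a})

-- In the absence of higher inductive types, a nullification is any higher
-- modality with the prescribed modal types; it is determined up to equivalence.
record Nullification {A : Set} (S : A → Set) : Set₁ where
  field
    modality     : HigherModality
  open HigherModality modality public
  field
    modal⇔null : (X : Set) → isModal X ⇔ isNull S X

-- The subuniverse of modal types; its initial object and natural numbers
-- object are the reflections of ⊥ and ℕ.
modalTypes : HigherModality → Universe
modalTypes M = record
  { Type = Σ Set isModal
  ; ⟦_⟧  = proj₁
  ; 𝟘    = ○ ⊥ , ○-isModal ⊥
  ; N    = ○ ℕ , ○-isModal ℕ
  ; succ = ○-map suc
  }
  where open HigherModality M

module _ (Ω¬¬ : StablePropClassifier 𝒰₀) where

  Oracle : Set → Set → Set
  Oracle A B = A → ∇₀ Ω¬¬ B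

  OracleModality : {A B : Set} → Oracle A B → Set₁
  OracleModality {A} {B} χ = Nullification {A} (λ a → _↓ Ω¬¬ {B} (χ a))

-- The classifier of ¬¬-stable propositions inside the subuniverse (where ¬¬ is
-- formed with ○ ⊥).  Since each χ(a)↓ is ¬¬-inhabited, ⊥, Ω and all ¬¬-stable
-- propositions are modal, so that Ω itself is also the internal classifier.
module _ (ext : Extensionality 0ℓ 0ℓ) (Ω¬¬ : StablePropClassifier 𝒰₀)
         {A B : Set} (χ : Oracle Ω¬¬ A B) (O : OracleModality Ω¬¬ χ) where
  open StablePropClassifier Ω¬¬
  open Nullification O

  private
    S : A → Set
    S a = _↓ Ω¬¬ {B} (χ a)

    S-inhabited : ∀ a → ¬ ¬ S a
    S-inhabited a = proj₁ (proj₂ (χ a))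

    S-connected : ∀ a (s t : S a) → ¬ ¬ (s ≡ t)
    S-connected a (x , p) (y , q) n =
      proj₂ (proj₂ (χ a)) x y p q λ x≡y → n (pair x≡y p q)
      where
      pair : ∀ {x y} → x ≡ y → (p : Holds (proj₁ (χ a) x))
             (q : Holds (proj₁ (χ a) y)) → _≡_ {A = S a} (x , p) (y , q)
      pair refl p q = cong (_ ,_) (isProp _ p q)

    null⇒modal : {X : Set} → isNull S X → isModal X
    null⇒modal = Equivalence.from (modal⇔null _)

    stableProp-isModal : {P : Set} → Irrelevant P → (¬ ¬ P → P) → isModal P
    stableProp-isModal {P} irr st = null⇒modal λ a →
      (g a , λ f → ext λ _ → irr _ _) , (g a , λ _ → irr _ _)
      where
      g : ∀ a → (S a → P) → P
      g a f = st λ n → S-inhabited a (n ∘ f)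

    ⊥-isModal : isModal ⊥
    ⊥-isModal = stableProp-isModal (λ ()) (λ k → k id)

    ○⊥-elim : ○ ⊥ → ⊥
    ○⊥-elim = proj₁ (proj₁ ⊥-isModal)

    isProp-≃ : {P Q : Set} → Irrelevant P → Irrelevant Q → (P → Q) → (Q → P) → P ≃ Q
    isProp-≃ p q f g = f , (g , λ _ → q _ _) , (g , λ _ → p _ _)

    Ω-ext : ∀ {ω ω'} → (Holds ω → Holds ω') → (Holds ω' → Holds ω) → ω ≡ ω'
    Ω-ext {ω} {ω'} f g = cong proj₁
      (trans (sym (center≡ (ω , isProp-≃ (isProp ω) (isProp ω') f g)))
             (center≡ (ω' , isProp-≃ (isProp ω') (isProp ω') id id)))
      where center≡ = proj₂ (classify (Holds ω') (isProp ω') (stable ω'))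

    Ω-isModal : isModal Ω
    Ω-isModal = null⇒modal λ a → (glue a , const-glue a) , (glue a , glue-const a)
      where
      module _ (a : A) (f : S a → Ω) where
        everywhere : isContr (Σ[ ω ∈ Ω ] (Holds ω ≃ (∀ s → Holds (f s))))
        everywhere = classify (∀ s → Holds (f s))
          (λ p q → ext λ s → isProp (f s) (p s) (q s))
          (λ k s → stable (f s) λ n → k λ p → n (p s))

        glue : Ω
        glue = proj₁ (proj₁ everywhere)

        out : Holds glue → ∀ s → Holds (f s)
        out = proj₁ (proj₂ (proj₁ everywhere))

        into : (∀ s → Holds (f s)) → Holds glue
        into = proj₁ (proj₁ (proj₂ (proj₂ (proj₁ everywhere))))

      const-glue : ∀ a f → const (glue a f) ≡ f
      const-glue a f = ext λ s → Ω-ext (λ h → out a f h s)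
        λ h → into a f λ t → stable (f t) λ n →
          S-connected a s t λ s≡t → n (subst (Holds ∘ f) s≡t h)

      glue-const : ∀ a ω → glue a (const ω) ≡ ω
      glue-const a ω = Ω-ext
        (λ h → stable ω λ n → S-inhabited a λ s → n (out a (const ω) h s))
        (λ h → into a (const ω) λ _ → h)

  Ω○ : StablePropClassifier (modalTypes modality)
  Ω○ = record
    { Ω        = Ω , Ω-isModal
    ; Holds    = λ ω → Holds ω , stableProp-isModal (isProp ω) (stable ω)
    ; isProp   = isProp
    ; stable   = λ ω k → stable ω λ n → ○⊥-elim (k (η ∘ n))
    ; classify = λ (P , _) irr st →
        classify P irr λ k → st λ n → η (k (○⊥-elim ∘ n))
    }

{-# OPTIONS --without-K #-}

-- Restriction along η : ℕ → ○ℕ sends an internal ∇₀(○ℕ) to ∇₀ℕ: negations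
-- agree because ○⊥ is empty, and η is injective because ○ℕ carries, Ω being
-- modal, the extension of each stable predicate m ≡_.  External Markov induction
-- is then applied to "P holds at every internal element whose restriction is
-- contained in ν".
module Submission where

open import Axiom.Extensionality.Propositional using (Extensionality)
open import Data.Empty using (⊥)
open import Data.Nat.Base using (ℕ; suc)
open import Data.Nat.Properties using (_≟_; ≡-irrelevant)
open import Data.Product using (Σ-syntax; _,_; proj₁; proj₂)
open import Function.Base using (_∘_; id; const)
open import Level using (0ℓ)
open import Relation.Binary.PropositionalEquality using (_≡_; refl; sym; cong; subst)
open import Relation.Nullary using (¬_)
open import Relation.Nullary.Decidable using (decidable-stable)
open import Defs

module _ (M : HigherModality) where
  open HigherModality M

  ○-map-η : {X Y : Set} (f : X → Y) (x : X) → ○-map f (η x) ≡ η (f x)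
  ○-map-η f = ○-ind-β _ (η ∘ f)

  modal-η-injective : {X : Set} → isModal X → {x y : X} → η x ≡ η y → x ≡ y
  modal-η-injective (_ , (h , h-η)) {x} {y} e =
    subst (_≡ y) (h-η x) (subst (λ z → h z ≡ y) (sym e) (h-η y))

  -- Through `○-map f`, the value `η (f x)` depends only on `η x`, and `η` is injective on a modal
  -- type.
  ○-separates : {X Y : Set} → isModal Y → (f : X → Y) →
                {x y : X} → η x ≡ η y → f x ≡ f y
  ○-separates modal f {x} {y} e = modal-η-injective modal
    (subst (_≡ η (f y)) (○-map-η f x)
      (subst (λ z → ○-map f z ≡ η (f y)) (sym e) (○-map-η f y)))

  -- Induction only yields `○ (¬ Q z)`; evaluating at `q` under `○` lands in `○ ⊥`.
  ○-ind-refute : ¬ ○ ⊥ → {X : Set} (Q : ○ X → Set) →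
                 (∀ x → ¬ Q (η x)) → ∀ z → ¬ Q z
  ○-ind-refute ○⊥-elim Q f z q =
    ○⊥-elim (○-ind (λ _ → ⊥) (λ k → η (k q)) (○-ind (¬_ ∘ Q) (η ∘ f) z))

module _ (ext : Extensionality 0ℓ 0ℓ) (Ω¬¬ : StablePropClassifier 𝒰₀)
         {A B : Set} (χ : Oracle Ω¬¬ A B) (O : OracleModality Ω¬¬ χ) where
  open StablePropClassifier Ω¬¬
  open Nullification O

  private
    Ω○¬¬ : StablePropClassifier (modalTypes modality)
    Ω○¬¬ = Ω○ ext Ω¬¬ χ O

    ℕ○ : Universe.Type (modalTypes modality)
    ℕ○ = Universe.N (modalTypes modality)

  -- An element of `○ ⊥` proves every internal double negation, so internal stability of the `ω`
  -- classifying `⊥` would give `Holds ω`, hence `⊥`.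
  ○⊥-empty : ¬ ○ ⊥
  ○⊥-empty z with classify ⊥ (λ ()) (λ k → k id)
  ... | (ω , holds→⊥ , _) , _ = holds→⊥ (StablePropClassifier.stable Ω○¬¬ ω (const z))

  ¬¬○⇒¬¬ : {X : Set} → ((X → ○ ⊥) → ○ ⊥) → ¬ ¬ X
  ¬¬○⇒¬¬ k n = ○⊥-empty (k (η ∘ n))

  η-ℕ-injective : {m n : ℕ} → η m ≡ η n → m ≡ n
  η-ℕ-injective {m} {n} e = from-code n (subst Holds same-code (to-code m refl))
    where
    code : (k : ℕ) → Σ[ ω ∈ Ω ] (Holds ω ≃ (m ≡ k))
    code k = proj₁ (classify (m ≡ k) ≡-irrelevant (decidable-stable (m ≟ k)))

    from-code : ∀ k → Holds (proj₁ (code k)) → m ≡ k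
    from-code k = proj₁ (proj₂ (code k))

    to-code : ∀ k → m ≡ k → Holds (proj₁ (code k))
    to-code k = proj₁ (proj₁ (proj₂ (proj₂ (code k))))

    same-code : proj₁ (code m) ≡ proj₁ (code n)
    same-code = ○-separates modality (proj₂ (StablePropClassifier.Ω Ω○¬¬)) (proj₁ ∘ code) e

  restrict : ∇₀ Ω○¬¬ ℕ○ → ∇₀ Ω¬¬ ℕ
  restrict (ξ , inhabited , unique) =
      ξ ∘ η
    , (λ n → ¬¬○⇒¬¬ inhabited λ (z , p) →
        -- The witness `z : ○ ℕ` is not given as some `η m`, but a refutation may be checked on the
        -- image of `η`.
        ○-ind-refute modality ○⊥-empty (Holds ∘ ξ) (λ m q → n (m , q)) z p)
    , λ x y p q n → ¬¬○⇒¬¬ (unique (η x) (η y) p q) (n ∘ η-ℕ-injective)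

  markovInduction-modal : MarkovInduction Ω¬¬ → MarkovInduction Ω○¬¬
  markovInduction-modal mi P h ν = mi P′ step (restrict ν) ν (λ _ p → p)
    where
    -- Quantifying over all such `ν` avoids extending `ν′` back to `○ ℕ`; containment avoids
    -- transport along equalities in `∇₀`.
    P′ : ∇₀ Ω¬¬ ℕ → Set
    P′ ν′ = (ν : ∇₀ Ω○¬¬ ℕ○) →
            (∀ n → Holds (proj₁ ν (η n)) → Holds (proj₁ ν′ n)) → proj₁ (P ν)

    step : ∀ ν′ → (∀ μ′ → IsSuc Ω¬¬ μ′ ν′ → P′ μ′) → P′ ν′
    step ν′ ih ν ν⊆ν′ = h ν λ μ μ+1≡ν →
      ih (restrict μ)
         -- `μ+1≡ν` puts `○-map suc (η m)` in `ν`; this equals `η (suc m)`, so containment puts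
         -- `suc m` in `ν′`.
         (λ m p → ν⊆ν′ (suc m)
           (subst (Holds ∘ proj₁ ν) (○-map-η modality suc m) (μ+1≡ν (η m) p)))
         μ (λ _ p → p)

mainTheorem11 : (ext : Extensionality 0ℓ 0ℓ) (Ω¬¬ : StablePropClassifier 𝒰₀) →
    MarkovInduction Ω¬¬ →
    {A B : Set} (χ : Oracle Ω¬¬ A B) (O : OracleModality Ω¬¬ χ) →
    MarkovInduction (Ω○ ext Ω¬¬ χ O)
mainTheorem11 ext Ω¬¬ mi χ O = markovInduction-modal ext Ω¬¬ χ O mi
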